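{- Let $p$ be a prime and $k\ge0$ an integer; put $f=2$ if $p=2$ and $f=1$ if $p>2$, and $d=f\cdot p^{2k}$. Let $r$ be a positive integer with $r\ge\lceil\sqrt{f d/2}\,\rceil$ such that, if $d>1$, then $p\nmid r$. Put $n=p^k r$ and $$a=2n+d=2p^kr+f p^{2k},\qquad b=2n+\frac{2n^2}{d}=2p^kr+\frac{2r^2}{f},\qquad c=b+d=2p^kr+\frac{2r^2}{f}+fp^{2k}.$$ Then $(a,b,c)$ is an IDPT. Moreover, every IDPT $(a,b,c)$ with $c-b=f\cdot p^{2k}$ arises in this way from some such $r$.
   Context: A Diophantine Pythagorean Triangle (DPT) is a triple $(a,b,c)$ of positive integers with $a<b<c$ and $a^2+b^2=c^2$. An IDPT is a DPT with $\gcd(a,b,c)=1$. $\lceil x\rceil$ is the smallest integer $\ge x$. -}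

module Defs where

open import Data.Bool using (true; false; if_then_else_)
open import Data.Integer as ℤ using (+_)
import Data.Integer.Properties as ℤ
open import Data.Nat using (ℕ; zero; suc; _+_; _*_; _^_; _≤_; _<_; _>_; _≡ᵇ_; NonZero; z≤n; s≤s)
open import Data.Nat.Divisibility using (_∤_)
open import Data.Nat.GCD using (gcd)
open import Data.Nat.Primality using (Prime; prime⇒nonZero)
import Data.Nat.Properties as ℕ
open import Data.Product using (∃; _×_; _,_; proj₁; proj₂)
open import Data.Rational as ℚ using (ℚ; mkℚ; _/_)
import Data.Rational.Properties as ℚ
open import Data.Rational.Unnormalised as ℚᵘ using (mkℚᵘ)
import Data.Rational.Unnormalised.Properties as ℚᵘ
open import Relation.Binary.PropositionalEquality using (_≡_; sym; subst₂)
open import Relation.Nullary using (yes; no; contradiction)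
open import Relation.Unary using (Decidable)

record IsDPT (a b c : ℕ) : Set where
  field
    0<a         : 0 < a
    a<b         : a < b
    b<c         : b < c
    pythagorean : a ^ 2 + b ^ 2 ≡ c ^ 2

record IsIDPT (a b c : ℕ) : Set where
  field
    isDPT : IsDPT a b c
    gcd≡1 : gcd a (gcd b c) ≡ 1

ι : ℕ → ℚ
ι m = + m / 1

-- √x ≤ m for natural m, with the square root eliminated.
√_≤_ : ℚ → ℕ → Set
√ x ≤ m = x ℚ.≤ ι (m ^ 2)

-- Searching ℕ suffices: for x ≥ 0, every integer that is at least √x is
-- nonnegative.  For x < 0, where √x is not real, the value is 0.
record IsCeilSqrt (x : ℚ) (m : ℕ) : Set where
  field
    upper : √ x ≤ m
    least : ∀ l → √ x ≤ l → m ≤ l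

private
  leastℕ : {P : ℕ → Set} → Decidable P → ∀ N → P N →
           ∃ λ m → P m × (∀ l → P l → m ≤ l)
  leastℕ P? N pN with P? 0
  ... | yes p0 = 0 , p0 , λ _ _ → z≤n
  leastℕ P? zero    pN | no ¬p0 = contradiction pN ¬p0
  leastℕ {P} P? (suc N) pN | no ¬p0 with leastℕ (λ l → P? (suc l)) N pN
  ... | m , pm , min = suc m , pm , min′
    where
    min′ : ∀ l → P l → suc m ≤ l
    min′ zero    p0 = contradiction p0 ¬p0
    min′ (suc l) pl = s≤s (min l pl)

  m≤m^2 : ∀ m → m ≤ m ^ 2
  m≤m^2 zero    = z≤n
  m≤m^2 (suc m) = ℕ.m≤m*n (suc m) (suc m ^ 1) {{ℕ.m^n≢0 (suc m) 1}}

  i≤+∣i∣ : ∀ i → i ℤ.≤ + ℤ.∣ i ∣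
  i≤+∣i∣ (+ _)      = ℤ.≤-refl
  i≤+∣i∣ ℤ.-[1+ _ ] = ℤ.-≤+

  bounded : ∀ x → √ x ≤ ℤ.∣ ℚ.↥ x ∣
  bounded x@(mkℚ i e _) = ℚ.toℚᵘ-cancel-≤
    (ℚᵘ.≤-respʳ-≃ (ℚᵘ.≃-sym (ℚ.toℚᵘ-fromℚᵘ (mkℚᵘ (+ q) 0)))
      (ℚᵘ.*≤* (subst₂ ℤ._≤_ (sym (ℤ.*-identityʳ i)) (ℤ.pos-* q (suc e))
        (ℤ.≤-trans (i≤+∣i∣ i) (ℤ.+≤+ (ℕ.≤-trans (m≤m^2 ℤ.∣ i ∣) (ℕ.m≤m*n q (suc e))))))))
    where q = ℤ.∣ i ∣ ^ 2

  ceilSqrt : ∀ x → ∃ λ m → √ x ≤ m × (∀ l → √ x ≤ l → m ≤ l)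
  ceilSqrt x = leastℕ (λ m → x ℚ.≤? ι (m ^ 2)) ℤ.∣ ℚ.↥ x ∣ (bounded x)

⌈√_⌉ : ℚ → ℕ
⌈√ x ⌉ = proj₁ (ceilSqrt x)

⌈√⌉-isCeilSqrt : ∀ x → IsCeilSqrt x ⌈√ x ⌉
⌈√⌉-isCeilSqrt x = record
  { upper = proj₁ (proj₂ (ceilSqrt x))
  ; least = proj₂ (proj₂ (ceilSqrt x))
  }

f : ℕ → ℕ
f p = if p ≡ᵇ 2 then 2 else 1

d : ℕ → ℕ → ℕ
d p k = f p * p ^ (2 * k)

f≢0 : ∀ p → NonZero (f p)
f≢0 p with p ≡ᵇ 2
... | true  = _
... | false = _

d≢0 : ∀ {p} → Prime p → ∀ k → NonZero (d p k)
d≢0 {p} p-prime k =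
  ℕ.m*n≢0 (f p) (p ^ (2 * k)) {{f≢0 p}} {{ℕ.m^n≢0 p (2 * k) {{prime⇒nonZero p-prime}}}}

record Admissible (p k r : ℕ) : Set where
  field
    positive : 0 < r
    bound    : ⌈√ + (f p * d p k) / 2 ⌉ ≤ r
    coprime  : d p k > 1 → p ∤ r

-- (a, b, c) is the triple given by the parameters p, k, r.  Equations that
-- involve a quotient are stated in ℚ, so that integrality of the quotient
-- is not presupposed (division on ℕ would round down).
record IsTripleOf {p : ℕ} (p-prime : Prime p) (k r a b c : ℕ) : Set where
  private
    n : ℕ
    n = p ^ k * r
    instance
      f-nonZero : NonZero (f p)
      f-nonZero = f≢0 p
      d-nonZero : NonZero (d p k)
      d-nonZero = d≢0 p-prime k
  field
    a-via-n : a ≡ 2 * n + d p k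
    a-via-r : a ≡ 2 * p ^ k * r + f p * p ^ (2 * k)
    b-via-n : ι b ≡ ι (2 * n) ℚ.+ + (2 * n ^ 2) / d p k
    b-via-r : ι b ≡ ι (2 * p ^ k * r) ℚ.+ + (2 * r ^ 2) / f p
    c-via-b : c ≡ b + d p k
    c-via-r : ι c ≡ ι (2 * p ^ k * r) ℚ.+ + (2 * r ^ 2) / f p ℚ.+ ι (f p * p ^ (2 * k))

{-# OPTIONS --safe #-}

-- Write D = c − b = d, E = c − a and B = a + b − c, so that a = B + D,
-- b = B + E and c = B + E + D.  The Pythagorean equation then reads B² = 2DE.
-- For D = f q² with q = pᵏ it forces B = 2qr and E = (2/f) r²; conversely these
-- values solve it.  The bound on r says D ≤ E, i.e. a ≤ b, and p is the only
-- prime that can divide both b and c, so primitivity amounts to p ∤ r.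
module Submission where

open import Defs
open import Data.Bool using (T; true; false; if_then_else_)
import Data.Integer as ℤ
import Data.Integer.Properties as ℤ
open import Data.List using ([]; _∷_)
open import Data.List.Relation.Unary.All using (_∷_)
open import Data.Nat using (ℕ; zero; suc; _+_; _*_; _^_; _∸_; _≤_; _<_; _>_; _≡ᵇ_; NonZero; ≢-nonZero; >-nonZero⁻¹; nonTrivial⇒n>1)
open import Data.Nat.Divisibility
open import Data.Nat.GCD using (gcd; gcd-greatest; gcd[m,n]∣m; gcd[m,n]∣n; gcd[m,n]≢0)
open import Data.Nat.ListAction using (product)
open import Data.Nat.Primality using (Prime; prime[2]; ¬prime[1]; prime⇒nonZero; prime⇒nonTrivial; prime⇒irreducible; irreducible[2]; euclidsLemma)
open import Data.Nat.Primality.Factorisation using (factorise)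
open import Data.Nat.Properties
open import Data.Nat.Tactic.RingSolver using (solve-∀)
open import Data.Product using (_×_; ∃-syntax; _,_)
import Data.Rational as ℚ
import Data.Rational.Properties as ℚ
open import Data.Rational.Unnormalised as ℚᵘ using (mkℚᵘ)
import Data.Rational.Unnormalised.Properties as ℚᵘ
open import Data.Sum using (inj₁; inj₂; [_,_]′)
open import Function using (_∘_)
open import Relation.Binary.PropositionalEquality using (_≡_; refl; sym; trans; cong; cong₂; subst; subst₂; module ≡-Reasoning)
open import Relation.Nullary using (¬_; contradiction)

-- Natural numbers as rationals

-- Equality of unnormalised fractions is cross-multiplication, so the gcd hidden in the normal form
-- of `_/_` never has to be evaluated.
/≡ι : ∀ m n e .{{_ : NonZero e}} → m ≡ n * e → ℤ.+ m ℚ./ e ≡ ι n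
/≡ι m n (suc e) m≡n*e = ℚ.fromℚᵘ-cong {mkℚᵘ (ℤ.+ m) e} {mkℚᵘ (ℤ.+ n) 0} (ℚᵘ.*≡* (begin
  ℤ.+ m ℤ.* ℤ.+ 1       ≡⟨ ℤ.*-identityʳ (ℤ.+ m) ⟩
  ℤ.+ m                 ≡⟨ cong ℤ.+_ m≡n*e ⟩
  ℤ.+ (n * suc e)       ≡⟨ ℤ.pos-* n (suc e) ⟩
  ℤ.+ n ℤ.* ℤ.+ suc e   ∎))
  where open ≡-Reasoning

ι-homo-+ : ∀ m n → ι (m + n) ≡ ι m ℚ.+ ι n
ι-homo-+ m n = ℚ.toℚᵘ-injective (begin-equality
  ℚ.toℚᵘ (ι (m + n))                 ≃⟨ ℚ.toℚᵘ-fromℚᵘ (mkℚᵘ (ℤ.+ (m + n)) 0) ⟩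
  mkℚᵘ (ℤ.+ (m + n)) 0               ≃⟨ ℚᵘ.*≡* (cong (ℤ._* ℤ.+ 1) numerators) ⟩
  mkℚᵘ (ℤ.+ m) 0 ℚᵘ.+ mkℚᵘ (ℤ.+ n) 0 ≃⟨ ℚᵘ.+-cong (ℚ.toℚᵘ-fromℚᵘ (mkℚᵘ (ℤ.+ m) 0)) (ℚ.toℚᵘ-fromℚᵘ (mkℚᵘ (ℤ.+ n) 0)) ⟨
  ℚ.toℚᵘ (ι m) ℚᵘ.+ ℚ.toℚᵘ (ι n)     ≃⟨ ℚ.toℚᵘ-homo-+ (ι m) (ι n) ⟨
  ℚ.toℚᵘ (ι m ℚ.+ ι n)               ∎)
  where
  open ℚᵘ.≤-Reasoning
  numerators : ℤ.+ (m + n) ≡ ℤ.+ m ℤ.* ℤ.+ 1 ℤ.+ ℤ.+ n ℤ.* ℤ.+ 1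
  numerators = sym (cong₂ ℤ._+_ (ℤ.*-identityʳ (ℤ.+ m)) (ℤ.*-identityʳ (ℤ.+ n)))

/≤ι⇒≤* : ∀ m e .{{_ : NonZero e}} n → ℤ.+ m ℚ./ e ℚ.≤ ι n → m ≤ n * e
/≤ι⇒≤* m (suc e) n m/e≤n
  with ℚᵘ.*≤* m*1≤n*e ← ℚᵘ.≤-respˡ-≃ (ℚ.toℚᵘ-fromℚᵘ (mkℚᵘ (ℤ.+ m) e))
         (ℚᵘ.≤-respʳ-≃ (ℚ.toℚᵘ-fromℚᵘ (mkℚᵘ (ℤ.+ n) 0)) (ℚ.toℚᵘ-mono-≤ m/e≤n))
  = ℤ.drop‿+≤+ (begin
      ℤ.+ m                ≡⟨ ℤ.*-identityʳ (ℤ.+ m) ⟨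
      ℤ.+ m ℤ.* ℤ.+ 1      ≤⟨ m*1≤n*e ⟩
      ℤ.+ n ℤ.* ℤ.+ suc e  ≡⟨ ℤ.pos-* n (suc e) ⟨
      ℤ.+ (n * suc e)      ∎)
  where open ℤ.≤-Reasoning

≤*⇒/≤ι : ∀ m e .{{_ : NonZero e}} n → m ≤ n * e → ℤ.+ m ℚ./ e ℚ.≤ ι n
≤*⇒/≤ι m (suc e) n m≤n*e = ℚ.toℚᵘ-cancel-≤
  (ℚᵘ.≤-respˡ-≃ (ℚᵘ.≃-sym (ℚ.toℚᵘ-fromℚᵘ (mkℚᵘ (ℤ.+ m) e)))
    (ℚᵘ.≤-respʳ-≃ (ℚᵘ.≃-sym (ℚ.toℚᵘ-fromℚᵘ (mkℚᵘ (ℤ.+ n) 0))) (ℚᵘ.*≤* (begin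
      ℤ.+ m ℤ.* ℤ.+ 1      ≡⟨ ℤ.*-identityʳ (ℤ.+ m) ⟩
      ℤ.+ m                ≤⟨ ℤ.+≤+ m≤n*e ⟩
      ℤ.+ (n * suc e)      ≡⟨ ℤ.pos-* n (suc e) ⟩
      ℤ.+ n ℤ.* ℤ.+ suc e  ∎))))
  where open ℤ.≤-Reasoning

-- With its converse below, this trades the bound on `r` for an inequality between naturals. Only
-- the two defining properties of the ceiling enter, one in each direction.
⌈√/⌉≤⇒≤ : ∀ m e .{{_ : NonZero e}} r → ⌈√ ℤ.+ m ℚ./ e ⌉ ≤ r → m ≤ r ^ 2 * e
⌈√/⌉≤⇒≤ m e r ⌈√⌉≤r = ≤-trans
  (/≤ι⇒≤* m e (⌈√ ℤ.+ m ℚ./ e ⌉ ^ 2) (IsCeilSqrt.upper (⌈√⌉-isCeilSqrt (ℤ.+ m ℚ./ e))))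
  (*-monoˡ-≤ e (^-monoˡ-≤ 2 ⌈√⌉≤r))

≤⇒⌈√/⌉≤ : ∀ m e .{{_ : NonZero e}} r → m ≤ r ^ 2 * e → ⌈√ ℤ.+ m ℚ./ e ⌉ ≤ r
≤⇒⌈√/⌉≤ m e r m≤r²e =
  IsCeilSqrt.least (⌈√⌉-isCeilSqrt (ℤ.+ m ℚ./ e)) r (≤*⇒/≤ι m e (r ^ 2) m≤r²e)

-- Primes

prime≢1 : ∀ {p} → Prime p → ¬ p ≡ 1
prime≢1 p-prime refl = ¬prime[1] p-prime

prime∣prime⇒≡ : ∀ {p q} → Prime p → Prime q → p ∣ q → p ≡ q
prime∣prime⇒≡ p-prime q-prime p∣q with prime⇒irreducible q-prime p∣q
... | inj₁ p≡1 = contradiction p≡1 (prime≢1 p-prime)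
... | inj₂ p≡q = p≡q

prime∣^⇒∣ : ∀ {p} → Prime p → ∀ m k → p ∣ m ^ k → p ∣ m
prime∣^⇒∣ p-prime m zero    p∣1 = contradiction (∣1⇒≡1 p∣1) (prime≢1 p-prime)
prime∣^⇒∣ p-prime m (suc k) p∣m^1+k with euclidsLemma m (m ^ k) p-prime p∣m^1+k
... | inj₁ p∣m   = p∣m
... | inj₂ p∣m^k = prime∣^⇒∣ p-prime m k p∣m^k

prime∣square⇒∣ : ∀ {p} → Prime p → ∀ m → p ∣ m * m → p ∣ m
prime∣square⇒∣ p-prime m p∣m*m with euclidsLemma m m p-prime p∣m*m
... | inj₁ p∣m = p∣m
... | inj₂ p∣m = p∣m

-- Induction on `k`: `p` divides `m * m`, hence `m`, and cancelling `p * p` on both sides leaves the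
-- same claim for `k` and `m / p`.
square-∣⇒∣ : ∀ {p} → Prime p → ∀ k m → p ^ k * p ^ k ∣ m * m → p ^ k ∣ m
square-∣⇒∣ p-prime zero m _ = 1∣ m
square-∣⇒∣ {p} p-prime (suc k) m q²∣m²
  with prime∣square⇒∣ p-prime m (m*n∣⇒m∣ p (p ^ k) (m*n∣⇒m∣ _ (p ^ suc k) q²∣m²))
... | divides-refl m′ = ∣-trans
    (*-monoʳ-∣ p (square-∣⇒∣ p-prime k m′ (*-cancelˡ-∣ (p * p) p²q²∣p²m′²)))
    (∣-reflexive (*-comm p m′))
  where
  instance _ = m*n≢0 p p {{prime⇒nonZero p-prime}} {{prime⇒nonZero p-prime}}
  regroup : ∀ x y → (y * x) * (y * x) ≡ (x * x) * (y * y)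
  regroup = solve-∀
  p²q²∣p²m′² : p * p * (p ^ k * p ^ k) ∣ p * p * (m′ * m′)
  p²q²∣p²m′² = subst₂ _∣_ ([m*n]*[o*p]≡[m*o]*[n*p] p (p ^ k) p (p ^ k)) (regroup p m′) q²∣m²

-- Reduces primitivity to excluding one common prime at a time: the first prime of a nonempty
-- factorisation would divide `n`.
no-prime-divisor⇒≡1 : ∀ n .{{_ : NonZero n}} → (∀ {π} → Prime π → π ∤ n) → n ≡ 1
no-prime-divisor⇒≡1 n ∤n with factorise n
... | record { factors = []     ; isFactorisation = n≡1 } = n≡1
... | record { factors = π ∷ πs ; isFactorisation = n≡π*Π ; factorsPrime = π-prime ∷ _ } =
  contradiction (divides (product πs) (trans n≡π*Π (*-comm π (product πs)))) (∤n π-prime)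

-- The equation B² = 2DE

-- Here and below, squares are unfolded to x * (x * 1) for the ring solver, which
-- fails on _^_.
pythagorean-identity : ∀ B D E →
  ((B + D) * ((B + D) * 1) + (B + E) * ((B + E) * 1)) + 2 * (D * E)
    ≡ (B + E + D) * ((B + E + D) * 1) + B * B
pythagorean-identity = solve-∀

B²≡2DE⇒pythagorean : ∀ B D E → B * B ≡ 2 * (D * E) →
                     (B + D) ^ 2 + (B + E) ^ 2 ≡ (B + E + D) ^ 2
B²≡2DE⇒pythagorean B D E B²≡2DE = +-cancelʳ-≡ (2 * (D * E)) _ _
  (trans (pythagorean-identity B D E) (cong ((B + E + D) ^ 2 +_) B²≡2DE))

pythagorean⇒B²≡2DE : ∀ B D E → (B + D) ^ 2 + (B + E) ^ 2 ≡ (B + E + D) ^ 2 →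
                     B * B ≡ 2 * (D * E)
pythagorean⇒B²≡2DE B D E pyth = sym (+-cancelˡ-≡ ((B + E + D) ^ 2) _ _
  (trans (cong (_+ 2 * (D * E)) (sym pyth)) (pythagorean-identity B D E)))

-- Ensures that B = a + b - c is a natural number. Otherwise c² would exceed (a + b)², which is
-- already at least a² + b².
pythagorean⇒c≤a+b : ∀ {a b c} → a ^ 2 + b ^ 2 ≡ c ^ 2 → c ≤ a + b
pythagorean⇒c≤a+b {a} {b} {c} pyth = ≮⇒≥ λ a+b<c → <-irrefl refl (begin-strict
  (a + b) ^ 2                    <⟨ ^-monoˡ-< 2 a+b<c ⟩
  c ^ 2                          ≡⟨ pyth ⟨
  a ^ 2 + b ^ 2                  ≤⟨ m≤m+n _ _ ⟩
  a ^ 2 + b ^ 2 + 2 * (a * b)    ≡⟨ binomial a b ⟨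
  (a + b) ^ 2                    ∎)
  where
  open ≤-Reasoning
  binomial : ∀ a b → (a + b) * ((a + b) * 1) ≡ a * (a * 1) + b * (b * 1) + 2 * (a * b)
  binomial = solve-∀

-- The roles of `u` and `v` are played later by f and 2/f. Only their product enters, so p = 2 and
-- odd p are treated together.
module _ (u v : ℕ) (u*v≡2 : u * v ≡ 2) where

  private instance
    u≢0 : NonZero u
    u≢0 = m*n≢0⇒m≢0 u {v} {{subst NonZero (sym u*v≡2) _}}

  parameters-solve : ∀ q r → 2 * (q * r) * (2 * (q * r)) ≡ 2 * (u * (q * q) * (v * (r * r)))
  parameters-solve q r = begin
    2 * (q * r) * (2 * (q * r))          ≡⟨ lhs q r ⟩
    2 * (2 * (q * q * (r * r)))          ≡⟨ cong (λ t → 2 * (t * (q * q * (r * r)))) u*v≡2 ⟨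
    2 * (u * v * (q * q * (r * r)))      ≡⟨ rhs u v q r ⟨
    2 * (u * (q * q) * (v * (r * r)))    ∎
    where
    open ≡-Reasoning
    lhs : ∀ q r → 2 * (q * r) * (2 * (q * r)) ≡ 2 * (2 * (q * q * (r * r)))
    lhs = solve-∀
    rhs : ∀ u v q r → 2 * (u * (q * q) * (v * (r * r))) ≡ 2 * (u * v * (q * q * (r * r)))
    rhs = solve-∀

  private
    q²-last : ∀ u q E → 2 * (u * (q * q) * E) ≡ 2 * (u * E) * (q * q)
    q²-last = solve-∀

  -- With q = pᵏ, the square q² divides B², so B = mq and m² = 2uE. Hence m is even, say m = 2r, and
  -- uE = 2r² = uvr²; cancelling `u` gives E.
  solutions-parametrised : ∀ {p} → Prime p → ∀ k {B E} →
    B * B ≡ 2 * (u * (p ^ k * p ^ k) * E) →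
    ∃[ r ] (B ≡ 2 * (p ^ k * r) × E ≡ v * (r * r))
  solutions-parametrised {p} p-prime k {B} {E} B²≡2DE
    with B²≡2uE*q² ← trans B²≡2DE (q²-last u (p ^ k) E)
    with square-∣⇒∣ p-prime k B (divides (2 * (u * E)) B²≡2uE*q²)
  ... | divides-refl m = r , B≡2qr , E≡vr²
    where
    q = p ^ k
    instance
      q≢0 : NonZero q
      q≢0 = m^n≢0 p k {{prime⇒nonZero p-prime}}
      q²≢0 : NonZero (q * q)
      q²≢0 = m*n≢0 q q
    m²≡2uE : m * m ≡ 2 * (u * E)
    m²≡2uE = *-cancelʳ-≡ _ _ (q * q) (trans ([m*n]*[o*p]≡[m*o]*[n*p] m m q q) B²≡2uE*q²)
    2∣m : 2 ∣ m
    2∣m = prime∣square⇒∣ prime[2] m (divides (u * E) (trans m²≡2uE (*-comm 2 (u * E))))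
    r = quotient 2∣m
    m≡r*2 : m ≡ r * 2
    m≡r*2 = m∣n⇒n≡quotient*m 2∣m
    B≡2qr : m * q ≡ 2 * (q * r)
    B≡2qr = trans (cong (_* q) m≡r*2) (regroup q r)
      where
      regroup : ∀ q r → r * 2 * q ≡ 2 * (q * r)
      regroup = solve-∀
    uE≡2r² : u * E ≡ 2 * (r * r)
    uE≡2r² = *-cancelˡ-≡ _ _ 2 (trans (sym m²≡2uE) (trans (cong₂ _*_ m≡r*2 m≡r*2) (regroup r)))
      where
      regroup : ∀ r → r * 2 * (r * 2) ≡ 2 * (2 * (r * r))
      regroup = solve-∀
    E≡vr² : E ≡ v * (r * r)
    E≡vr² = *-cancelˡ-≡ _ _ u (begin
      u * E               ≡⟨ uE≡2r² ⟩
      2 * (r * r)         ≡⟨ cong (_* (r * r)) u*v≡2 ⟨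
      u * v * (r * r)     ≡⟨ *-assoc u v (r * r) ⟩
      u * (v * (r * r))   ∎)
      where open ≡-Reasoning

-- The constants f and d

-- A natural number standing for the quotient, so that E = 2r²/f can be written without division.
2/f : ℕ → ℕ
2/f p = if p ≡ᵇ 2 then 1 else 2

f*2/f≡2 : ∀ p → f p * 2/f p ≡ 2
f*2/f≡2 p with p ≡ᵇ 2
... | true  = refl
... | false = refl

f∣p : ∀ p → f p ∣ p
f∣p p with p ≡ᵇ 2 in eq
... | false = 1∣ p
... | true  with refl ← ≡ᵇ⇒≡ p 2 (subst T (sym eq) _) = ∣-refl

-- When p = 2 the factor 2 is absorbed by f and 1 remains; when p is odd, 2 remains.
p∤2/f : ∀ {p} → Prime p → p ∤ 2/f p
p∤2/f {p} p-prime p∣h with p ≡ᵇ 2 in eq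
... | true = prime≢1 p-prime (∣1⇒≡1 p∣h)
... | false with irreducible[2] p∣h
...   | inj₁ p≡1 = prime≢1 p-prime p≡1
...   | inj₂ refl with () ← eq

d≡fq² : ∀ p k → d p k ≡ f p * (p ^ k * p ^ k)
d≡fq² p k = cong (f p *_) (trans (cong (p ^_) (cong (k +_) (+-identityʳ k))) (^-distribˡ-+-* p k k))

-- Since f divides p, d divides the power of p with exponent 2k + 1.
prime∣d⇒≡p : ∀ {p π} → Prime p → Prime π → ∀ k → π ∣ d p k → π ≡ p
prime∣d⇒≡p {p} p-prime π-prime k π∣d = prime∣prime⇒≡ π-prime p-prime
  (prime∣^⇒∣ π-prime p (suc (2 * k)) (∣-trans π∣d (*-monoˡ-∣ (p ^ (2 * k)) (f∣p p))))

-- For p = 2 the factor f supplies the prime; for odd p, d > 1 forces k > 0. With the converse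
-- below, the condition d > 1 amounts to p dividing d.
d>1⇒p∣d : ∀ p k → d p k > 1 → p ∣ d p k
d>1⇒p∣d p k d>1 with p ≡ᵇ 2 in eq
... | true with refl ← ≡ᵇ⇒≡ p 2 (subst T (sym eq) _) = m∣m*n (2 ^ (2 * k))
d>1⇒p∣d p zero    d>1 | false = contradiction d>1 (<-irrefl refl)
d>1⇒p∣d p (suc k) d>1 | false = ∣n⇒∣m*n 1 (m∣m*n (p ^ (k + suc (k + 0))))

p∣d⇒d>1 : ∀ {p} → Prime p → ∀ k → p ∣ d p k → d p k > 1
p∣d⇒d>1 {p} p-prime k p∣d =
  <-≤-trans (nonTrivial⇒n>1 p {{prime⇒nonTrivial p-prime}}) (∣⇒≤ {{d≢0 p-prime k}} p∣d)

-- Used to see that p divides B = 2qr. As d = fq², either p divides f, which divides 2, or p divides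
-- q.
p∣d⇒p∣2q : ∀ {p} → Prime p → ∀ k → p ∣ d p k → p ∣ 2 * p ^ k
p∣d⇒p∣2q {p} p-prime k p∣d
  with euclidsLemma (f p) (p ^ k * p ^ k) p-prime (subst (p ∣_) (d≡fq² p k) p∣d)
... | inj₁ p∣f  = ∣m⇒∣m*n (p ^ k) (subst (p ∣_) (f*2/f≡2 p) (∣m⇒∣m*n (2/f p) p∣f))
... | inj₂ p∣q² = ∣n⇒∣m*n 2 (prime∣square⇒∣ p-prime (p ^ k) p∣q²)

p∤2/f*r² : ∀ {p} → Prime p → ∀ {r} → p ∤ r → p ∤ 2/f p * (r * r)
p∤2/f*r² {p} p-prime {r} p∤r p∣hr² =
  [ p∤2/f p-prime , p∤r ∘ prime∣square⇒∣ p-prime r ]′ (euclidsLemma (2/f p) (r * r) p-prime p∣hr²)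

f*2/f*r²≡r²*2 : ∀ p r → f p * (2/f p * (r * r)) ≡ r ^ 2 * 2
f*2/f*r²≡r²*2 p r = begin
  f p * (2/f p * (r * r))   ≡⟨ *-assoc (f p) (2/f p) (r * r) ⟨
  f p * 2/f p * (r * r)     ≡⟨ cong (_* (r * r)) (f*2/f≡2 p) ⟩
  2 * (r * r)               ≡⟨ regroup r ⟩
  r ^ 2 * 2                 ∎
  where
  open ≡-Reasoning
  regroup : ∀ r → 2 * (r * r) ≡ r * (r * 1) * 2
  regroup = solve-∀

-- Multiplication by f turns D ≤ E into fd ≤ 2r², which is the squared form of the bound on `r`.
d≤⇒fd≤ : ∀ p k r → d p k ≤ 2/f p * (r * r) → f p * d p k ≤ r ^ 2 * 2
d≤⇒fd≤ p k r d≤ = ≤-trans (*-monoʳ-≤ (f p) d≤) (≤-reflexive (f*2/f*r²≡r²*2 p r))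

fd≤⇒d≤ : ∀ p k r → f p * d p k ≤ r ^ 2 * 2 → d p k ≤ 2/f p * (r * r)
fd≤⇒d≤ p k r fd≤ =
  *-cancelˡ-≤ (f p) {{f≢0 p}} (≤-trans fd≤ (≤-reflexive (sym (f*2/f*r²≡r²*2 p r))))

-- Makes a ≤ b strict. If d > 1, then p divides the left side but not the right; if d = 1, both f
-- and 2/f would be 1, although their product is 2.
d≢2/f*r² : ∀ {p} → Prime p → ∀ k {r} → (d p k > 1 → p ∤ r) → ¬ d p k ≡ 2/f p * (r * r)
d≢2/f*r² {p} p-prime k {r} coprime d≡hr² with m≤n⇒m<n∨m≡n (>-nonZero⁻¹ (d p k) {{d≢0 p-prime k}})
... | inj₁ d>1 = p∤2/f*r² p-prime (coprime d>1) (subst (p ∣_) d≡hr² (d>1⇒p∣d p k d>1))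
... | inj₂ 1≡d = contradiction (trans (sym (cong₂ _*_ f≡1 2/f≡1)) (f*2/f≡2 p)) λ ()
  where
  f≡1 : f p ≡ 1
  f≡1 = m*n≡1⇒m≡1 (f p) (p ^ (2 * k)) (sym 1≡d)
  2/f≡1 : 2/f p ≡ 1
  2/f≡1 = m*n≡1⇒m≡1 (2/f p) (r * r) (sym (trans 1≡d d≡hr²))

-- Triples with parameter r

module _ {p : ℕ} (p-prime : Prime p) (k : ℕ) where

  private
    q D : ℕ
    q = p ^ k
    D = d p k

    B E : ℕ → ℕ
    B r = 2 * (q * r)
    E r = 2/f p * (r * r)

    B²≡2DE : ∀ r → B r * B r ≡ 2 * (D * E r)
    B²≡2DE r = trans (parameters-solve (f p) (2/f p) (f*2/f≡2 p) q r)
      (cong (λ x → 2 * (x * E r)) (sym (d≡fq² p k)))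

  isTripleOf : ∀ r → IsTripleOf p-prime k r (B r + D) (B r + E r) (B r + E r + D)
  isTripleOf r = record
    { a-via-n = refl
    ; a-via-r = cong (_+ D) B≡
    ; b-via-n = trans (ι-homo-+ (B r) (E r)) (cong (ι (B r) ℚ.+_) (sym 2n²/d≡ι))
    ; b-via-r = b≡
    ; c-via-b = refl
    ; c-via-r = trans (ι-homo-+ (B r + E r) D) (cong (ℚ._+ ι D) b≡)
    }
    where
    instance
      f-nonZero : NonZero (f p)
      f-nonZero = f≢0 p
      d-nonZero : NonZero D
      d-nonZero = d≢0 p-prime k
    B≡ : B r ≡ 2 * q * r
    B≡ = sym (*-assoc 2 q r)
    2n²/d≡ι : ℤ.+ (2 * (q * r) ^ 2) ℚ./ D ≡ ι (E r)
    -- Twice 2n² is (2n)² = B² = 2DE; cancelling 2 shows that the quotient by D is exactly E.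
    2n²/d≡ι = /≡ι (2 * (q * r) ^ 2) (E r) D (*-cancelˡ-≡ _ _ 2 (trans (regroup (q * r)) (trans (B²≡2DE r) (cong (2 *_) (*-comm D (E r))))))
      where
      regroup : ∀ n → 2 * (2 * (n * (n * 1))) ≡ 2 * n * (2 * n)
      regroup = solve-∀
    2r²/f≡ι : ℤ.+ (2 * r ^ 2) ℚ./ f p ≡ ι (E r)
    2r²/f≡ι = /≡ι (2 * r ^ 2) (E r) (f p) (trans (cong (_* r ^ 2) (sym (f*2/f≡2 p))) (regroup (f p) (2/f p) r))
      where
      regroup : ∀ u v r → u * v * (r * (r * 1)) ≡ v * (r * r) * u
      regroup = solve-∀
    b≡ : ι (B r + E r) ≡ ι (2 * q * r) ℚ.+ ℤ.+ (2 * r ^ 2) ℚ./ f p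
    b≡ = trans (ι-homo-+ (B r) (E r)) (cong₂ ℚ._+_ (cong ι B≡) (sym 2r²/f≡ι))

  isIDPT : ∀ {r} → Admissible p k r → IsIDPT (B r + D) (B r + E r) (B r + E r + D)
  isIDPT {r} adm = record
    { isDPT = record
      { 0<a         = 0<a
      ; a<b         = +-monoʳ-< (B r) D<E
      ; b<c         = m<m+n (B r + E r) 0<D
      ; pythagorean = B²≡2DE⇒pythagorean (B r) D (E r) (B²≡2DE r)
      }
    ; gcd≡1 = no-prime-divisor⇒≡1 _ {{≢-nonZero (gcd[m,n]≢0 _ _ (inj₁ (m<n⇒n≢0 0<a)))}} no-common-prime
    }
    where
    open Admissible adm
    0<D : 0 < D
    0<D = >-nonZero⁻¹ D {{d≢0 p-prime k}}
    0<a : 0 < B r + D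
    0<a = <-≤-trans 0<D (m≤n+m D (B r))
    D<E : D < E r
    -- The bound yields only D ≤ E; coprimality rules out equality.
    D<E = ≤∧≢⇒< (fd≤⇒d≤ p k r (⌈√/⌉≤⇒≤ (f p * D) 2 r bound)) (d≢2/f*r² p-prime k coprime)
    -- A prime dividing b and c divides D = c - b, so it is p. Then p divides B as well, hence E = b
    -- - B, which contradicts p ∤ r.
    no-common-prime : ∀ {π} → Prime π → π ∤ gcd (B r + D) (gcd (B r + E r) (B r + E r + D))
    no-common-prime {π} π-prime π∣gcd = p∤2/f*r² p-prime (coprime (p∣d⇒d>1 p-prime k p∣D))
      (∣m+n∣m⇒∣n p∣b p∣B)
      where
      π∣gcd-bc = ∣-trans π∣gcd (gcd[m,n]∣n (B r + D) _)
      π∣b = ∣-trans π∣gcd-bc (gcd[m,n]∣m (B r + E r) _)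
      π∣D = ∣m+n∣m⇒∣n (∣-trans π∣gcd-bc (gcd[m,n]∣n (B r + E r) _)) π∣b
      π≡p = prime∣d⇒≡p p-prime π-prime k π∣D
      p∣D = subst (_∣ D) π≡p π∣D
      p∣b = subst (_∣ B r + E r) π≡p π∣b
      p∣B : p ∣ B r
      p∣B = subst (p ∣_) (*-assoc 2 q r) (∣m⇒∣m*n r (p∣d⇒p∣2q p-prime k p∣D))

  -- From a < b comes D < E, which gives the bound and excludes r = 0, where E vanishes. If d > 1
  -- and p divided r, then p would divide B, D and E, hence the whole triple.
  isIDPT⇒admissible : ∀ {r} → IsIDPT (B r + D) (B r + E r) (B r + E r + D) → Admissible p k r
  isIDPT⇒admissible {r} idpt = record
    { positive = positive D<E
    ; bound    = ≤⇒⌈√/⌉≤ (f p * D) 2 r (d≤⇒fd≤ p k r (<⇒≤ D<E))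
    ; coprime  = p∤r
    }
    where
    open IsIDPT idpt
    D<E : D < E r
    D<E = +-cancelˡ-< (B r) D (E r) (IsDPT.a<b isDPT)
    positive : ∀ {r} → D < E r → 0 < r
    positive {zero}  D<E₀ = contradiction (subst (D <_) (*-zeroʳ (2/f p)) D<E₀) n≮0
    positive {suc _} _    = 0<1+n
    p∤r : D > 1 → p ∤ r
    p∤r D>1 p∣r = prime≢1 p-prime (∣1⇒≡1 (subst (p ∣_) gcd≡1
      (gcd-greatest (∣m∣n⇒∣m+n p∣B p∣D) (gcd-greatest p∣b (∣m∣n⇒∣m+n p∣b p∣D)))))
      where
      p∣D = d>1⇒p∣d p k D>1
      p∣B : p ∣ B r
      p∣B = ∣n⇒∣m*n 2 (∣n⇒∣m*n q p∣r)
      p∣b : p ∣ B r + E r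
      p∣b = ∣m∣n⇒∣m+n p∣B (∣n⇒∣m*n (2/f p) (∣n⇒∣m*n r p∣r))

  isDPT-parametrised : ∀ {a b c} → IsDPT a b c → c ∸ b ≡ D →
    ∃[ r ] (a ≡ B r + D × b ≡ B r + E r × c ≡ B r + E r + D)
  isDPT-parametrised {a} {b} {c} dpt c∸b≡D
    -- Truncated subtraction is a true difference here because b < c.
    with b+D≡c ← trans (cong (b +_) (sym c∸b≡D)) (m+[n∸m]≡n (<⇒≤ (IsDPT.b<c dpt)))
    -- From b + D = c ≤ a + b follows D ≤ a, so a = D + B₀; then B₀ ≤ a < b provides E₀ with b = B₀
    -- + E₀.
    with D≤a ← +-cancelˡ-≤ b D a (≤-trans (≤-reflexive b+D≡c)
                 (≤-trans (pythagorean⇒c≤a+b {a} {b} (IsDPT.pythagorean dpt)) (≤-reflexive (+-comm a b))))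
    with B₀ , refl ← m≤n⇒∃[o]m+o≡n D≤a
    with E₀ , refl ← m≤n⇒∃[o]m+o≡n (≤-trans (m≤n+m B₀ D) (<⇒≤ (IsDPT.a<b dpt)))
    with refl ← b+D≡c
    with r , refl , refl ← solutions-parametrised (f p) (2/f p) (f*2/f≡2 p) p-prime k {B₀} {E₀}
           (trans (pythagorean⇒B²≡2DE B₀ D E₀
                    (trans (cong (λ x → x ^ 2 + (B₀ + E₀) ^ 2) (+-comm B₀ D)) (IsDPT.pythagorean dpt)))
                  (cong (λ x → 2 * (x * E₀)) (d≡fq² p k)))
    = r , +-comm D (B r) , refl , refl

theorem4 : ∀ (p : ℕ) (p-prime : Prime p) (k : ℕ) →
    (∀ r → Admissible p k r →
    ∃[ a ] ∃[ b ] ∃[ c ] (IsTripleOf p-prime k r a b c × IsIDPT a b c))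
    ×
    (∀ a b c → IsIDPT a b c → c ∸ b ≡ d p k →
    ∃[ r ] (Admissible p k r × IsTripleOf p-prime k r a b c))
theorem4 p p-prime k = parametrised , exhausted
  where
  parametrised : ∀ r → Admissible p k r →
    ∃[ a ] ∃[ b ] ∃[ c ] (IsTripleOf p-prime k r a b c × IsIDPT a b c)
  parametrised r adm = _ , _ , _ , isTripleOf p-prime k r , isIDPT p-prime k adm

  exhausted : ∀ a b c → IsIDPT a b c → c ∸ b ≡ d p k →
    ∃[ r ] (Admissible p k r × IsTripleOf p-prime k r a b c)
  exhausted a b c idpt c∸b≡d
    with r , refl , refl , refl ← isDPT-parametrised p-prime k (IsIDPT.isDPT idpt) c∸b≡d
    = r , isIDPT⇒admissible p-prime k idpt , isTripleOf p-prime k r
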